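{- Let $A=(1,a_1,\ldots,a_k)$ be an orderly currency with $k\geq 3$, $a_2>2a_1$ and $a_3>2a_2$. Then the currency $(1,a_1,a_2,a_l)$ is orderly for every $4\leq l\leq k$.
   Context: A currency is a finite sequence of integers $A=(a_0,a_1,\ldots,a_k)$ with $1=a_0<a_1<\cdots<a_k$. For an integer amount $c>0$, $\mathrm{opt}_A(c)$ is the minimum number of coins (values from $A$, repetitions allowed) summing to $c$, and $\mathrm{grd}_A(c)$ is the number of coins used by the greedy algorithm, which repeatedly takes the largest coin not exceeding the remaining amount. $A$ is orderly if $\mathrm{opt}_A(c)=\mathrm{grd}_A(c)$ for all integers $c>0$. -}

module Defs where

open import Data.Nat using (ℕ; zero; suc; _+_; _*_; _∸_; _≤_; _<_; _⊔_; _≤ᵇ_)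
open import Data.Fin using (Fin; zero; suc; toℕ)
open import Data.List using (List; tabulate; foldr)
open import Data.Bool using (if_then_else_)
open import Data.Product using (Σ; _×_)
open import Relation.Binary.PropositionalEquality using (_≡_)

Σᶠ : {n : ℕ} → (Fin n → ℕ) → ℕ
Σᶠ {zero}  f = 0
Σᶠ {suc n} f = f zero + Σᶠ (λ i → f (suc i))

IsCurrency : {k : ℕ} → (Fin (suc k) → ℕ) → Set
IsCurrency {k} a = (a zero ≡ 1) × (∀ (i j : Fin (suc k)) → toℕ i < toℕ j → a i < a j)

IsRep : {k : ℕ} → (Fin (suc k) → ℕ) → ℕ → (Fin (suc k) → ℕ) → Set
IsRep a c m = Σᶠ (λ i → m i * a i) ≡ c

coins : {k : ℕ} → (Fin (suc k) → ℕ) → ℕ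
coins m = Σᶠ m

IsOpt : {k : ℕ} → (Fin (suc k) → ℕ) → ℕ → ℕ → Set
IsOpt a c n =
  Σ _ (λ m → IsRep a c m × coins m ≡ n) × (∀ m → IsRep a c m → n ≤ coins m)

-- largest coin not exceeding c (0 if none)
largest : {k : ℕ} → (Fin (suc k) → ℕ) → ℕ → ℕ
largest a c = foldr (λ x r → if x ≤ᵇ c then x ⊔ r else r) 0 (tabulate a)

grdFuel : {k : ℕ} → (Fin (suc k) → ℕ) → ℕ → ℕ → ℕ
grdFuel a zero    c       = 0
grdFuel a (suc f) zero    = 0
grdFuel a (suc f) (suc c) = suc (grdFuel a f (suc c ∸ largest a (suc c)))

-- grd_A(c); fuel c suffices since a_0 = 1 means each step removes ≥ 1.
grd : {k : ℕ} → (Fin (suc k) → ℕ) → ℕ → ℕ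
grd a c = grdFuel a c c

Orderly : {k : ℕ} → (Fin (suc k) → ℕ) → Set
Orderly a = ∀ c → 0 < c → IsOpt a c (grd a c)

sub4 : {m : ℕ} → (Fin (4 + m) → ℕ) → Fin (4 + m) → Fin 4 → ℕ
sub4 a l zero = a zero
sub4 a l (suc zero) = a (suc zero)
sub4 a l (suc (suc zero)) = a (suc (suc zero))
sub4 a l (suc (suc (suc zero))) = a l

{-# OPTIONS --safe #-}
module Submission where

-- Call z ∈ {0} ∪ A a residue. By orderliness, if s is the top coin of the sum of two coins
-- y + z, then y + z − s is a residue. From this alone it follows that coins from a₃ on are at
-- least a₂ apart: for a minimal pair x < x′ violating this, downward induction shows that all
-- coins are so far apart that x′ − x < a₂ is impossible. Hence, for l ≥ 3 and m = ⌈a_l / a₂⌉,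
-- the top coin of m a₂ is a_l, so the greedy payment of m a₂ shows that m a₂ − a_l can be paid
-- with less than m coins, necessarily 1's and a₁'s. Likewise for a₁ and a₂, since
-- ⌈a₂ / a₁⌉ a₁ < a₃. So 1, a₁, a₂, a_l can be added one at a time by the one-point theorem.

open import Defs
open import Data.Nat using (ℕ; zero; suc; _+_; _*_; _∸_; _<_; _≤_; _≤?_; _<?_; _≤ᵇ_; _⊔_; _/_; _%_; NonZero; >-nonZero; z≤n; s≤s; s≤s⁻¹)
open import Data.Nat.Properties
open import Data.Nat.DivMod using (m<n⇒m/n≡0; m<n⇒m%n≡m; [m+n]%n≡m%n; m/n≡1+[m∸n]/n)
open import Data.Nat.Induction using (<-rec)
open import Data.Nat.Solver using (module +-*-Solver)
open import Data.Fin using (Fin; zero; suc; toℕ)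
open import Data.Fin.Patterns using (0F; 1F; 2F; 3F)
open import Data.Fin.Properties using (toℕ-injective)
open import Data.List using (foldr; tabulate)
open import Data.Bool using (if_then_else_; true; false)
open import Data.Product using (∃-syntax; _×_; _,_; proj₁; proj₂)
open import Data.Sum using (_⊎_; inj₁; inj₂)
open import Data.Empty using (⊥; ⊥-elim)
open import Function using (id; _∘_)
open import Relation.Nullary using (yes; no; contradiction)
open import Relation.Nullary.Reflects using (ofʸ; ofⁿ)
open import Relation.Binary.PropositionalEquality using (_≡_; refl; sym; trans; cong; cong₂; subst; subst₂)

private variable
  n : ℕ

m∸n≤o⇒m≤o+n : ∀ m n {o} → m ∸ n ≤ o → m ≤ o + n
m∸n≤o⇒m≤o+n m n {o} le = ≤-trans (m≤n+m∸n m n)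
  (≤-trans (+-monoʳ-≤ n le) (≤-reflexive (+-comm n o)))

-- Representations

value : (Fin n → ℕ) → (Fin n → ℕ) → ℕ
value a m = Σᶠ (λ i → m i * a i)

Σᶠ-cong : {f g : Fin n → ℕ} → (∀ i → f i ≡ g i) → Σᶠ f ≡ Σᶠ g
Σᶠ-cong {zero}  eq = refl
Σᶠ-cong {suc n} eq = cong₂ _+_ (eq zero) (Σᶠ-cong (eq ∘ suc))

Σᶠ-0 : ∀ n → Σᶠ {n} (λ _ → 0) ≡ 0
Σᶠ-0 zero    = refl
Σᶠ-0 (suc n) = Σᶠ-0 n

Σᶠ-+ : (f g : Fin n → ℕ) → Σᶠ (λ i → f i + g i) ≡ Σᶠ f + Σᶠ g
Σᶠ-+ {zero}  f g = refl
Σᶠ-+ {suc n} f g = trans (cong (f zero + g zero +_) (Σᶠ-+ (f ∘ suc) (g ∘ suc)))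
  (solve 4 (λ a b c d → a :+ b :+ (c :+ d) := a :+ c :+ (b :+ d)) refl
    (f zero) (g zero) (Σᶠ (f ∘ suc)) (Σᶠ (g ∘ suc)))
  where open +-*-Solver

value-+ : (a m m′ : Fin n → ℕ) → value a (λ i → m i + m′ i) ≡ value a m + value a m′
value-+ a m m′ = trans (Σᶠ-cong (λ i → *-distribʳ-+ (a i) (m i) (m′ i)))
  (Σᶠ-+ (λ i → m i * a i) (λ i → m′ i * a i))

copies : Fin n → ℕ → Fin n → ℕ
copies zero    c zero    = c
copies zero    c (suc j) = 0
copies (suc i) c zero    = 0
copies (suc i) c (suc j) = copies i c j

Σᶠ-copies : (i : Fin n) (c : ℕ) → Σᶠ (copies i c) ≡ c
Σᶠ-copies {suc n} zero c = trans (cong (c +_) (Σᶠ-0 n)) (+-identityʳ c)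
Σᶠ-copies (suc i) c = Σᶠ-copies i c

value-copies : (a : Fin n → ℕ) (i : Fin n) (c : ℕ) → value a (copies i c) ≡ c * a i
value-copies {suc n} a zero c = trans (cong (c * a zero +_) (Σᶠ-0 n)) (+-identityʳ _)
value-copies a (suc i) c = value-copies (a ∘ suc) i c

term≤Σᶠ : (f : Fin n → ℕ) (i : Fin n) → f i ≤ Σᶠ f
term≤Σᶠ f zero    = m≤m+n _ _
term≤Σᶠ f (suc i) = ≤-trans (term≤Σᶠ (f ∘ suc) i) (m≤n+m _ (f zero))

-- The greedy algorithm

-- The fold of `largest`, freed from the shape `Fin (suc k)` so that induction on the length can
-- reach the empty family.
largestOf : (Fin n → ℕ) → ℕ → ℕ
largestOf a c = foldr (λ x r → if x ≤ᵇ c then x ⊔ r else r) 0 (tabulate a)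

largestOf-upper : (a : Fin n → ℕ) (c : ℕ) (i : Fin n) → a i ≤ c → a i ≤ largestOf a c
largestOf-upper a c zero a≤c with a zero ≤ᵇ c | ≤ᵇ-reflects-≤ (a zero) c
... | true  | _        = m≤m⊔n _ _
... | false | ofⁿ a≰c = contradiction a≤c a≰c
largestOf-upper a c (suc i) a≤c with a zero ≤ᵇ c
... | true  = ≤-trans (largestOf-upper (a ∘ suc) c i a≤c) (m≤n⊔m (a zero) _)
... | false = largestOf-upper (a ∘ suc) c i a≤c

largestOf-attained : (a : Fin n → ℕ) (c : ℕ) →
  largestOf a c ≡ 0 ⊎ ∃[ i ] (largestOf a c ≡ a i × a i ≤ c)
largestOf-attained {zero}  a c = inj₁ refl
largestOf-attained {suc n} a c
  with a zero ≤ᵇ c | ≤ᵇ-reflects-≤ (a zero) c | largestOf-attained (a ∘ suc) c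
... | false | _ | inj₁ eq = inj₁ eq
... | false | _ | inj₂ (i , eq , a≤c) = inj₂ (suc i , eq , a≤c)
... | true | ofʸ a≤c | rest with ⊔-sel (a zero) (largestOf (a ∘ suc) c) | rest
... | inj₁ eq | _ = inj₂ (zero , eq , a≤c)
... | inj₂ eq | inj₁ eq′ = inj₁ (trans eq eq′)
... | inj₂ eq | inj₂ (i , eq′ , a≤c′) = inj₂ (suc i , trans eq eq′ , a≤c′)

IsTop : (Fin n → ℕ) → ℕ → Fin n → Set
IsTop a c i = a i ≤ c × (∀ j → a j ≤ c → a j ≤ a i)

module _ {k} (a : Fin (suc k) → ℕ) where

  largest-top : ∀ {c i} → 0 < a i → IsTop a c i → largest a c ≡ a i
  largest-top {c} {i} 0<a (a≤c , top) with largestOf-attained a c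
  ... | inj₁ eq = contradiction (subst (a i ≤_) eq (largestOf-upper a c i a≤c)) (<⇒≱ 0<a)
  ... | inj₂ (j , eq , aj≤c) = trans eq (≤-antisym (top j aj≤c)
          (subst (a i ≤_) eq (largestOf-upper a c i a≤c)))

  top-coin : a zero ≡ 1 → ∀ {c} → 0 < c → ∃[ i ] IsTop a c i
  top-coin a₀ {c} 0<c with largestOf-attained a c
  ... | inj₁ eq = contradiction
          (subst₂ _≤_ a₀ eq (largestOf-upper a c zero (subst (_≤ c) (sym a₀) 0<c))) λ ()
  ... | inj₂ (i , eq , a≤c) = i , a≤c , λ j aj≤c → subst (a j ≤_) eq (largestOf-upper a c j aj≤c)

  module _ (a₀ : a zero ≡ 1) (0<a : ∀ i → 0 < a i) where

    -- Any fuel `f ≥ c` is allowed because a step lowers the fuel by one but the amount possibly by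
    -- more.
    greedy-rep : ∀ f c → c ≤ f → ∃[ m ] (value a m ≡ c × Σᶠ m ≡ grdFuel a f c)
    greedy-rep zero    zero    _ = (λ _ → 0) , Σᶠ-0 (suc k) , Σᶠ-0 (suc k)
    greedy-rep (suc f) zero    _ = (λ _ → 0) , Σᶠ-0 (suc k) , Σᶠ-0 (suc k)
    greedy-rep (suc f) (suc c) (s≤s c≤f) with top-coin a₀ {suc c} (s≤s z≤n)
    ... | i , top rewrite largest-top (0<a i) top
        with greedy-rep f (suc c ∸ a i) (≤-trans (∸-monoʳ-≤ (suc c) (0<a i)) c≤f)
    ... | m , rep , count = (λ j → copies i 1 j + m j)
        , trans (value-+ a (copies i 1) m)
            (trans (cong₂ _+_ (trans (value-copies a i 1) (*-identityˡ (a i))) rep)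
              (m+[n∸m]≡n (proj₁ top)))
        , trans (Σᶠ-+ (copies i 1) m) (cong₂ _+_ (Σᶠ-copies i 1) count)

    -- All that is used of an orderly currency: after removing the top coin, the rest of any
    -- amount can be paid with one coin less than any given payment of the amount.
    top-residue : Orderly a → ∀ {c i} m → value a m ≡ c → 0 < c → IsTop a c i →
      ∃[ m′ ] (value a m′ ≡ c ∸ a i × Σᶠ m′ < Σᶠ m)
    top-residue orderly {suc c} {i} m rep 0<c top
      with proj₂ (orderly (suc c) 0<c) m rep
    ... | grd≤m rewrite largest-top (0<a i) top
        with greedy-rep c (suc c ∸ a i) (∸-monoʳ-≤ (suc c) (0<a i))
    ... | m′ , rep′ , count = m′ , rep′ , subst (_< Σᶠ m) (sym count) grd≤m

-- Gaps between coins

-- p, q, r stand for a₁, a₂, a₃, and C₀ holds of the residues.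
module _ (C : ℕ → Set) (p q r T : ℕ) where

  private
    C₀ : ℕ → Set
    C₀ y = y ≡ 0 ⊎ C y

  module _
    (closed : ∀ {y z} → C y → C z →
      ∃[ s ] (C s × s ≤ y + z × (∀ {t} → C t → t ≤ y + z → t ≤ s) × C₀ (y + z ∸ s)))
    (small : ∀ {y} → C y → y < r → y ≤ p ⊎ y ≡ q)
    (Cq : C q) (Cr : C r) (2p<q : p + p < q) (2q<r : q + q < r)
    (bound : ∀ {y} → C y → y ≤ T)
    where

    private
      small₀ : ∀ {y} → C₀ y → y < r → y ≤ p ⊎ y ≡ q
      small₀ (inj₁ refl) _ = inj₁ z≤n
      small₀ (inj₂ cy) y<r = small cy y<r

      -- Either `X + w` is already the top coin of `X + z`, and `closed` makes the rest `z ∸ w` a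
      -- residue, or the top coin exceeds it by some `h`.
      top-sum : ∀ {X w z} → C X → C z → C (X + w) → w ≤ z →
        (C₀ (z ∸ w) × (∀ {t} → C t → t ≤ X + z → t ≤ X + w)) ⊎
        ∃[ h ] (0 < h × C (X + w + h) × w + h ≤ z)
      top-sum {X} {w} {z} cX cz cw w≤z with closed cX cz
      ... | s , cs , s≤ , top , rest with m≤n⇒m<n∨m≡n (top cw (+-monoʳ-≤ X w≤z))
      ... | inj₂ refl = inj₁ (subst C₀ ([m+n]∸[m+o]≡n∸o X z w) rest , top)
      ... | inj₁ X+w<s = inj₂ (s ∸ (X + w) , m<n⇒0<n∸m X+w<s
              , subst C (sym split) cs
              , +-cancelˡ-≤ X _ _ (subst (_≤ X + z) (trans (sym split) (+-assoc X w _)) s≤))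
        where
          split : X + w + (s ∸ (X + w)) ≡ s
          split = m+[n∸m]≡n (<⇒≤ X+w<s)

      module Pair {x d} (cx : C x) (r≤x : r ≤ x) (0<d : 0 < d) (d<q : d < q) (cx′ : C (x + d))
        (minimal : ∀ {y} → y < x → C y → r ≤ y → C (y + d) → ⊥) where

        p<q : p < q
        p<q = ≤-trans (s≤s (m≤m+n p p)) 2p<q

        q<r : q < r
        q<r = ≤-trans (s≤s (m≤m+n q q)) 2q<r

        -- By minimality of `x`, a pair of coins at distance `d` further down starts below `r`,
        -- where coins are at most `p` or equal to `q`. The start `q` is out, as `q + d` would lie
        -- strictly between `q` and `r`.
        below : ∀ {y} → y < x → C₀ y → C₀ (y + d) → y ≤ p × y + d ≤ q
        below _ (inj₁ refl) _ = z≤n , <⇒≤ d<q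
        below {y} _ (inj₂ cy) (inj₁ eq) =
          contradiction (m+n≡0⇒n≡0 y eq) (>⇒≢ 0<d)
        below {y} y<x (inj₂ cy) (inj₂ cy′) with y <? r
        ... | no y≮r = ⊥-elim (minimal y<x cy (≮⇒≥ y≮r) cy′)
        ... | yes y<r with small cy y<r
        ...   | inj₂ refl with small cy′ (<-trans (+-monoʳ-< q d<q) 2q<r)
        ...     | inj₁ q+d≤p = contradiction (≤-trans (m≤m+n q d) q+d≤p) (<⇒≱ p<q)
        ...     | inj₂ q+d≡q = contradiction (sym q+d≡q) (<⇒≢ (m<m+n q 0<d))
        below {y} y<x (inj₂ cy) (inj₂ cy′) | yes y<r | inj₁ y≤p
          with small cy′ (<-trans (+-mono-≤-< (≤-trans y≤p (<⇒≤ p<q)) d<q) 2q<r)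
        ...     | inj₁ le = y≤p , ≤-trans le (<⇒≤ p<q)
        ...     | inj₂ eq = y≤p , ≤-reflexive eq

        Large : ℕ → Set
        Large w = x ≤ w + p × x + d ≤ w + q

        q<x∸p : ∀ {h} → x ≤ h + p → q < h
        q<x∸p {h} x≤h+p = +-cancelʳ-< p q h
          (≤-trans (s≤s (+-monoʳ-≤ q (<⇒≤ p<q))) (≤-trans 2q<r (≤-trans r≤x x≤h+p)))

        -- Downward induction on X. If X + w is the top coin of X + x + d, the pair x, x + d
        -- moves down by w, to a pair known to be small. Otherwise a large gap h follows X + w,
        -- and then X + r, and after that X + q, leaves a rest that is not a coin.
        large-gap : ∀ n {X w} → T ≤ X + n → C X → C (X + w) → 0 < w → Large w
        -- `n` bounds the room left between `X` and `T`; with none left, no coin lies above `X`.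
        large-gap zero {X} {w} T≤X cX cw 0<w =
          contradiction (≤-trans (bound cw) (subst (T ≤_) (+-identityʳ X) T≤X)) (<⇒≱ (m<m+n X 0<w))
        large-gap (suc n) {X} {w} T≤ cX cw 0<w with x ≤? w
        ... | yes x≤w = ≤-trans x≤w (m≤m+n w p) , +-mono-≤ x≤w (<⇒≤ d<q)
        ... | no x≰w = go (top-sum cX cx′ cw (≤-trans w≤x (m≤m+n x d)))
          where
            w≤x : w ≤ x
            w≤x = <⇒≤ (≰⇒> x≰w)

            next : ∀ {h} → 0 < h → C (X + w + h) → Large h
            next 0<h ch = large-gap n
              (≤-trans T≤ (subst (_≤ X + w + n) (sym (+-suc X n)) (+-monoˡ-≤ n (m<m+n X 0<w))))
              cw ch 0<h

            absurd-q : w ≤ p → ⊥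
            absurd-q w≤p with top-sum cX Cq cw (≤-trans w≤p (<⇒≤ p<q))
            ... | inj₂ (h , 0<h , ch , w+h≤q) =
              contradiction (≤-trans (m≤n+m h w) w+h≤q) (<⇒≱ (q<x∸p (proj₁ (next 0<h ch))))
            -- Since `0 < w ≤ p` and `p + p < q`, the rest `q ∸ w` lies strictly between `p` and
            -- `q`, where no residue is.
            ... | inj₁ (rest , _) with small₀ rest (≤-trans (s≤s (m∸n≤m q w)) q<r)
            ...   | inj₁ le = contradiction (≤-trans (m∸n≤o⇒m≤o+n q w le) (+-monoʳ-≤ p w≤p)) (<⇒≱ 2p<q)
            ...   | inj₂ eq = contradiction eq (<⇒≢ (∸-monoʳ-< 0<w (≤-trans w≤p (<⇒≤ p<q))))

            absurd-r : w ≤ q → ⊥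
            absurd-r w≤q with top-sum cX Cr cw (≤-trans w≤q (<⇒≤ q<r))
            -- `w + h ≤ r ≤ x ≤ h + p` gives `w ≤ p`.
            ... | inj₂ (h , 0<h , ch , w+h≤r) = absurd-q
              (+-cancelʳ-≤ h w p (≤-trans w+h≤r (≤-trans r≤x
                (subst (x ≤_) (+-comm h p) (proj₁ (next 0<h ch))))))
            -- Here the rest `r ∸ w` lies strictly between `q` and `r`.
            ... | inj₁ (rest , _) with q<r∸w ← m+n≤o⇒m≤o∸n (suc q) (≤-trans (s≤s (+-monoʳ-≤ q w≤q)) 2q<r)
              with small₀ rest (∸-monoʳ-< 0<w (≤-trans w≤q (<⇒≤ q<r)))
            ...   | inj₁ le = contradiction (≤-trans le (<⇒≤ p<q)) (<⇒≱ q<r∸w)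
            ...   | inj₂ eq = contradiction (sym eq) (<⇒≢ q<r∸w)

            go : (C₀ (x + d ∸ w) × (∀ {t} → C t → t ≤ X + (x + d) → t ≤ X + w)) ⊎
              ∃[ h ] (0 < h × C (X + w + h) × w + h ≤ x + d) → Large w
            -- `w + h ≤ x + d ≤ h + q` gives `w ≤ q`.
            go (inj₂ (h , 0<h , ch , w+h≤x′)) = ⊥-elim (absurd-r (+-cancelʳ-≤ h w q
              (≤-trans w+h≤x′ (subst (x + d ≤_) (+-comm h q) (proj₂ (next 0<h ch))))))
            -- `X + w` is also the top coin of the smaller `X + x`, so `x ∸ w` and `x + d ∸ w` are
            -- both residues and `below` applies to them.
            go (inj₁ (rest′ , top)) with top-sum cX cx cw w≤x
            ... | inj₂ (h , 0<h , ch , w+h≤x) = contradiction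
              (top ch (subst (_≤ X + (x + d)) (sym (+-assoc X w h))
                (+-monoʳ-≤ X (≤-trans w+h≤x (m≤m+n x d)))))
              (<⇒≱ (m<m+n (X + w) 0<h))
            ... | inj₁ (rest , _)
              with below (∸-monoʳ-< 0<w w≤x) rest (subst C₀ (+-∸-comm d w≤x) rest′)
            ...   | le , le′ = subst (x ≤_) (+-comm p w) (m∸n≤o⇒m≤o+n x w le)
                    , subst (x + d ≤_) (+-comm q w)
                        (m∸n≤o⇒m≤o+n (x + d) w (subst (_≤ q) (sym (+-∸-comm d w≤x)) le′))

        absurd : ⊥
        -- The gap `d` after `x` would itself have to be large, hence exceed `q`.
        absurd = contradiction (q<x∸p (proj₁ (large-gap T (m≤n+m T x) cx cx′ 0<d))) (<⇒≯ d<q)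

      no-pair : ∀ x d → C x → r ≤ x → C (x + d) → 0 < d → d < q → ⊥
      -- Strong induction on `x` supplies the minimality, always for the same `d`.
      no-pair = <-rec _ λ x minimal d cx r≤x cx′ 0<d d<q →
        Pair.absurd cx r≤x 0<d d<q cx′
          λ y<x cy r≤y cy′ → minimal y<x d cy r≤y cy′ 0<d d<q

    gap≥q : ∀ {x x′} → C x → r ≤ x → C x′ → x < x′ → x + q ≤ x′
    gap≥q {x} {x′} cx r≤x cx′ x<x′ with x + q ≤? x′
    ... | yes le = le
    ... | no ≰ = ⊥-elim (no-pair x (x′ ∸ x) cx r≤x
            (subst C (sym (m+[n∸m]≡n (<⇒≤ x<x′))) cx′) (m<n⇒0<n∸m x<x′)
            (+-cancelˡ-< x _ _ (subst (_< x + q) (sym (m+[n∸m]≡n (<⇒≤ x<x′))) (≰⇒> ≰))))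

-- Cost functions

-- Models the least number of coins in an orderly currency with largest coin `b`: `subadditive`
-- carries optimality, `largest-one` says that greedy takes `b` first.
record Cost (f : ℕ → ℕ) (b : ℕ) : Set where
  field
    zero-cost   : f 0 ≡ 0
    subadditive : ∀ u v → f (u + v) ≤ f u + f v
    largest-one : ∀ n → f (b + n) ≡ suc (f n)

  multiple : ∀ m n → f (m * b + n) ≡ m + f n
  multiple zero    n = refl
  multiple (suc m) n = trans (cong f (+-assoc b (m * b) n))
    (trans (largest-one (m * b + n)) (cong suc (multiple m n)))

  copies≤ : ∀ m y → f y ≤ 1 → f (m * y) ≤ m
  copies≤ zero    y _   = ≤-reflexive zero-cost
  copies≤ (suc m) y fy≤1 = ≤-trans (subadditive y (m * y)) (+-mono-≤ fy≤1 (copies≤ m y fy≤1))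

  -- The bound on `f (a i)` is asked only of coins in use, so that a payment in the whole currency
  -- can be measured by the cost of a smaller one.
  value≤ : ∀ {n} (a m : Fin n → ℕ) → (∀ i → 0 < m i → f (a i) ≤ 1) → f (value a m) ≤ Σᶠ m
  value≤ {zero}  a m _ = ≤-reflexive zero-cost
  value≤ {suc n} a m one = ≤-trans (subadditive (m zero * a zero) _)
    (+-mono-≤ (first (m zero) (one zero)) (value≤ (a ∘ suc) (m ∘ suc) (one ∘ suc)))
    where
      first : ∀ k → (0 < k → f (a zero) ≤ 1) → f (k * a zero) ≤ k
      first zero    _   = ≤-reflexive zero-cost
      first (suc k) one = copies≤ (suc k) (a zero) (one (s≤s z≤n))

  b-one : f b ≤ 1
  b-one = ≤-reflexive (trans (cong f (sym (+-identityʳ b)))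
    (trans (largest-one 0) (cong suc zero-cost)))

id-cost : Cost id 1
id-cost = record { zero-cost = refl ; subadditive = λ u v → ≤-refl ; largest-one = λ n → refl }

-- `F` is the cost after adjoining a coin `c` that is taken first whenever possible. The two
-- equations keep the division in `extension` out of later proofs.
Extends : (ℕ → ℕ) → ℕ → (ℕ → ℕ) → Set
Extends f c F = (∀ {n} → n < c → F n ≡ f n) × (∀ n → F (c + n) ≡ suc (F n))

extension : ∀ f {c} → 0 < c → ∃[ F ] Extends f c F
extension f {c} 0<c = F , below , above
  where
    instance
      c≢0 : NonZero c
      c≢0 = >-nonZero 0<c
    F : ℕ → ℕ
    F n = n / c + f (n % c)
    below : ∀ {n} → n < c → F n ≡ f n
    below n<c = cong₂ (λ x y → x + f y) (m<n⇒m/n≡0 n<c) (m<n⇒m%n≡m n<c)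
    above : ∀ n → F (c + n) ≡ suc (F n)
    above n = cong₂ (λ x y → x + f y)
      (trans (m/n≡1+[m∸n]/n (m≤m+n c n)) (cong (λ z → suc (z / c)) (m+n∸m≡n c n)))
      (trans (cong (_% c) (+-comm c n)) ([m+n]%n≡m%n n c))

-- The one-point theorem of Magazine, Nemhauser and Trotter.
module _ {f F b c} (cost : Cost f b) (0<c : 0 < c) (ext : Extends f c F)
  {m δ} (m*b : m * b ≡ c + δ) (fδ<m : f δ < m) where

  open Cost cost

  private
    -- Paying `c + n` with the new coin is no worse than without it: `m + f n = f (c + n + δ) ≤ f (c
    -- + n) + f δ`, and `f δ` is less than `m`.
    trade : ∀ n → suc (f n) ≤ f (c + n)
    trade n = +-cancelʳ-≤ (f δ) _ _ (begin
      suc (f n) + f δ ≡⟨ +-suc (f n) (f δ) ⟨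
      f n + suc (f δ) ≤⟨ +-monoʳ-≤ (f n) fδ<m ⟩
      f n + m         ≡⟨ +-comm (f n) m ⟩
      m + f n         ≡⟨ multiple m n ⟨
      f (m * b + n)   ≡⟨ cong (λ z → f (z + n)) m*b ⟩
      f (c + δ + n)   ≡⟨ cong f (solve 3 (λ c d n → c :+ d :+ n := c :+ n :+ d) refl c δ n) ⟩
      f (c + n + δ)   ≤⟨ subadditive (c + n) δ ⟩
      f (c + n) + f δ ∎)
      where
        open ≤-Reasoning
        open +-*-Solver

    -- Induction on the sum `s`. If `u` or `v` is at least `c`, one coin `c` comes off both sides;
    -- if both are below `c` but the sum is not, `trade` reduces the claim to subadditivity of `f`.
    F-sub : ∀ s u v → u + v ≡ s → F (u + v) ≤ F u + F v
    F-sub = <-rec _ step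
      where
        open ≤-Reasoning
        P : ℕ → Set
        P s = ∀ u v → u + v ≡ s → F (u + v) ≤ F u + F v

        left : ∀ s → (∀ {t} → t < s → P t) → ∀ u v → u + v ≡ s → c ≤ u → F (u + v) ≤ F u + F v
        left s rec u v refl c≤u with u ∸ c | m+[n∸m]≡n c≤u
        ... | u′ | refl = begin
          F (c + u′ + v)    ≡⟨ cong F (+-assoc c u′ v) ⟩
          F (c + (u′ + v))  ≡⟨ proj₂ ext (u′ + v) ⟩
          suc (F (u′ + v))  ≤⟨ s≤s (rec (+-monoˡ-< v (m<n+m u′ 0<c)) u′ v refl) ⟩
          suc (F u′ + F v)  ≡⟨ cong (_+ F v) (proj₂ ext u′) ⟨
          F (c + u′) + F v  ∎

        step : ∀ s → (∀ {t} → t < s → P t) → P s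
        step s rec u v eq with c ≤? u | c ≤? v
        ... | yes c≤u | _ = left s rec u v eq c≤u
        ... | no _ | yes c≤v = subst₂ _≤_ (cong F (+-comm v u)) (+-comm (F v) (F u))
          (left s rec v u (trans (+-comm v u) eq) c≤v)
        ... | no c≰u | no c≰v
          rewrite proj₁ ext (≰⇒> c≰u) | proj₁ ext (≰⇒> c≰v) with c ≤? u + v
        ...   | no c≰ rewrite proj₁ ext (≰⇒> c≰) = subadditive u v
        ...   | yes c≤ = begin
          F (u + v)         ≡⟨ cong F (m+[n∸m]≡n c≤) ⟨
          F (c + w)         ≡⟨ proj₂ ext w ⟩
          suc (F w)         ≡⟨ cong suc (proj₁ ext w<c) ⟩
          suc (f w)         ≤⟨ trade w ⟩
          f (c + w)         ≡⟨ cong f (m+[n∸m]≡n c≤) ⟩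
          f (u + v)         ≤⟨ subadditive u v ⟩
          f u + f v         ∎
          where
            w : ℕ
            w = u + v ∸ c
            w<c : w < c
            w<c = +-cancelˡ-< c w c (subst (_< c + c) (sym (m+[n∸m]≡n c≤))
              (+-mono-< (≰⇒> c≰u) (≰⇒> c≰v)))

  one-point : Cost F c
  one-point = record
    { zero-cost   = trans (proj₁ ext 0<c) zero-cost
    ; subadditive = λ u v → F-sub (u + v) u v refl
    ; largest-one = proj₂ ext
    }

least-multiple : ∀ {b} → 0 < b → ∀ c → ∃[ m ] ∃[ δ ] (m * b ≡ c + δ × δ < b)
least-multiple 0<b zero = 0 , 0 , refl , 0<b
least-multiple {suc b} 0<b (suc c) with least-multiple 0<b c
... | m , suc δ , eq , δ<b = m , δ , trans eq (+-suc c δ) , <-trans (n<1+n δ) δ<b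
-- With no excess left, one more coin is required; the coin is `suc b`, so the new excess is `b`.
... | m , zero , eq , _ = suc m , b , cong suc (trans (cong (b +_) eq)
        (solve 2 (λ b c → b :+ (c :+ con 0) := c :+ b) refl b c)) , ≤-refl
  where open +-*-Solver

-- Four coins

module FourCoins (e : Fin 4 → ℕ) (currency : IsCurrency e) {F₁ F₂ F₃ : ℕ → ℕ}
  (ext₁ : Extends id (e 1F) F₁) (ext₂ : Extends F₁ (e 2F) F₂) (ext₃ : Extends F₂ (e 3F) F₃)
  (cost₁ : Cost F₁ (e 1F)) (cost₂ : Cost F₂ (e 2F)) (cost₃ : Cost F₃ (e 3F)) where

  private
    e₀ : e 0F ≡ 1
    e₀ = proj₁ currency

    mono : ∀ i j → toℕ i < toℕ j → e i < e j
    mono = proj₂ currency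

    -- Both amounts stay below the new coin `c`, where old and new cost agree.
    lift : ∀ {f F c n} t → Extends f c F → n < c → f n ≡ suc (f (n ∸ t)) → F n ≡ suc (F (n ∸ t))
    lift {n = n} t (below , _) n<c eq =
      trans (below n<c) (trans eq (cong suc (sym (below (≤-trans (s≤s (m∸n≤m n t)) n<c)))))

    top-step : ∀ {f F c n} → Extends f c F → c ≤ n → F n ≡ suc (F (n ∸ c))
    top-step {F = F} {c} {n} (_ , above) c≤n = trans (cong F (sym (m+[n∸m]≡n c≤n))) (above (n ∸ c))

    -- The recursion holds at the stage where the top coin is adjoined, and `lift` carries it past
    -- the larger coins, all of which exceed the amount.
    step : ∀ {n} i → IsTop e (suc n) i → F₃ (suc n) ≡ suc (F₃ (suc n ∸ e i))
    step {n} i (le , top) = by-index i (λ j i<j → ≰⇒> λ ej≤n → <⇒≱ (mono i j i<j) (top j ej≤n)) le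
      where
        by-index : ∀ i → (∀ j → toℕ i < toℕ j → suc n < e j) → e i ≤ suc n →
          F₃ (suc n) ≡ suc (F₃ (suc n ∸ e i))
        by-index 0F < _ = lift (e 0F) ext₃ (< 3F (s≤s z≤n)) (lift (e 0F) ext₂ (< 2F (s≤s z≤n))
          (lift (e 0F) ext₁ (< 1F (s≤s z≤n)) (cong (λ z → suc (suc n ∸ z)) (sym e₀))))
        by-index 1F < le = lift (e 1F) ext₃ (< 3F (s≤s (s≤s z≤n)))
          (lift (e 1F) ext₂ (< 2F (s≤s (s≤s z≤n))) (top-step ext₁ le))
        by-index 2F < le = lift (e 2F) ext₃ (< 3F ≤-refl) (top-step ext₂ le)
        by-index 3F _ le = top-step ext₃ le

  0<e : ∀ i → 0 < e i
  0<e 0F      = subst (0 <_) (sym e₀) (s≤s z≤n)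
  0<e (suc i) = ≤-trans (s≤s z≤n) (mono 0F (suc i) (s≤s z≤n))

  greedy≡cost : ∀ f n → n ≤ f → grdFuel e f n ≡ F₃ n
  greedy≡cost zero    zero    _ = sym (Cost.zero-cost cost₃)
  greedy≡cost (suc f) zero    _ = sym (Cost.zero-cost cost₃)
  greedy≡cost (suc f) (suc n) (s≤s n≤f) with top-coin e e₀ {suc n} (s≤s z≤n)
  ... | i , top rewrite largest-top e (0<e i) top = trans
    (cong suc (greedy≡cost f (suc n ∸ e i) (≤-trans (∸-monoʳ-≤ (suc n) (0<e i)) n≤f)))
    (sym (step i top))

  coin-cost : ∀ i → F₃ (e i) ≤ 1
  coin-cost 0F = subst (_≤ 1) (sym (trans (proj₁ ext₃ (mono 0F 3F (s≤s z≤n)))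
    (trans (proj₁ ext₂ (mono 0F 2F (s≤s z≤n))) (proj₁ ext₁ (mono 0F 1F (s≤s z≤n))))))
    (≤-reflexive e₀)
  coin-cost 1F = subst (_≤ 1) (sym (trans (proj₁ ext₃ (mono 1F 3F (s≤s (s≤s z≤n))))
    (proj₁ ext₂ (mono 1F 2F (s≤s (s≤s z≤n)))))) (Cost.b-one cost₁)
  coin-cost 2F = subst (_≤ 1) (sym (proj₁ ext₃ (mono 2F 3F ≤-refl))) (Cost.b-one cost₂)
  coin-cost 3F = Cost.b-one cost₃

  -- `F₃` links both sides: it is the greedy count by its recursion, and a lower bound for every
  -- payment by subadditivity.
  orderly : Orderly e
  orderly c 0<c = greedy-rep e e₀ 0<e c c ≤-refl , λ m rep → begin
      grd e c          ≡⟨ greedy≡cost c c ≤-refl ⟩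
      F₃ c             ≡⟨ cong F₃ rep ⟨
      F₃ (value e m)   ≤⟨ Cost.value≤ cost₃ e m (λ i _ → coin-cost i) ⟩
      coins m          ∎
    where open ≤-Reasoning

-- From the given currency to the four coins

payment-by-one : (a m : Fin n → ℕ) → Σᶠ m ≤ 1 → value a m ≡ 0 ⊎ ∃[ i ] a i ≡ value a m
payment-by-one {zero} a m _ = inj₁ refl
payment-by-one {suc n} a m m≤1 with m zero
... | zero with payment-by-one (a ∘ suc) (m ∘ suc) m≤1
...   | inj₁ eq = inj₁ eq
...   | inj₂ (i , eq) = inj₂ (suc i , eq)
payment-by-one {suc n} a m (s≤s m≤0) | suc k =
  inj₂ (zero , sym (trans (cong₂ _+_ (cong (λ z → suc z * a zero) k≡0) rest≡0)
    (trans (+-identityʳ _) (*-identityˡ (a zero)))))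
  where
    k≡0 : k ≡ 0
    k≡0 = n≤0⇒n≡0 (≤-trans (m≤m+n k _) m≤0)

    null : ∀ {n} (a m : Fin n → ℕ) → Σᶠ m ≤ 0 → value a m ≡ 0
    null {zero}  a m _ = refl
    null {suc n} a m m≤0 = cong₂ _+_
      (cong (_* a zero) (n≤0⇒n≡0 (≤-trans (m≤m+n (m zero) _) m≤0)))
      (null (a ∘ suc) (m ∘ suc) (≤-trans (m≤n+m _ (m zero)) m≤0))

    rest≡0 : value (a ∘ suc) (m ∘ suc) ≡ 0
    rest≡0 = null (a ∘ suc) (m ∘ suc) (≤-trans (m≤n+m _ k) m≤0)

module _ {k} (a : Fin (4 + k) → ℕ) (currency : IsCurrency a) (orderly : Orderly a)
  (2a₁<a₂ : 2 * a 1F < a 2F) (2a₂<a₃ : 2 * a 2F < a 3F) where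

  private
    a₀ : a 0F ≡ 1
    a₀ = proj₁ currency

    mono : ∀ i j → toℕ i < toℕ j → a i < a j
    mono = proj₂ currency

    0<a : ∀ i → 0 < a i
    0<a 0F      = subst (0 <_) (sym a₀) (s≤s z≤n)
    0<a (suc i) = ≤-trans (s≤s z≤n) (mono 0F (suc i) (s≤s z≤n))

    mono-≤ : ∀ i j → toℕ i ≤ toℕ j → a i ≤ a j
    mono-≤ i j i≤j with m≤n⇒m<n∨m≡n i≤j
    ... | inj₁ i<j = <⇒≤ (mono i j i<j)
    ... | inj₂ eq = ≤-reflexive (cong a (toℕ-injective eq))

    double : ∀ x → 2 * x ≡ x + x
    double x = cong (x +_) (+-identityʳ x)

    IsCoin : ℕ → Set
    IsCoin y = ∃[ i ] a i ≡ y

  coin-gap : ∀ i j → 3 ≤ toℕ i → toℕ i < toℕ j → a i + a 2F ≤ a j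
  -- `Σᶠ a` serves as `T`, a bound for every coin.
  coin-gap i j 3≤i i<j = gap≥q IsCoin (a 1F) (a 2F) (a 3F) (Σᶠ a) closed small
    (2F , refl) (3F , refl)
    (subst (_< a 2F) (double (a 1F)) 2a₁<a₂) (subst (_< a 3F) (double (a 2F)) 2a₂<a₃)
    (λ { (i , refl) → term≤Σᶠ a i })
    (i , refl) (mono-≤ 3F i 3≤i) (j , refl) (mono i j i<j)
    where
      closed : ∀ {y z} → IsCoin y → IsCoin z → ∃[ s ] (IsCoin s × s ≤ y + z ×
        (∀ {t} → IsCoin t → t ≤ y + z → t ≤ s) × (y + z ∸ s ≡ 0 ⊎ IsCoin (y + z ∸ s)))
      closed (i , refl) (j , refl) with top-coin a a₀ (≤-trans (0<a i) (m≤m+n (a i) (a j)))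
      -- Adding the two families also covers `i = j`. Two coins are paid, so the rest takes at most
      -- one and is a residue.
      ... | s , top with top-residue a a₀ 0<a orderly (λ t → copies i 1 t + copies j 1 t)
              (trans (value-+ a (copies i 1) (copies j 1))
                (cong₂ _+_ (trans (value-copies a i 1) (*-identityˡ (a i)))
                  (trans (value-copies a j 1) (*-identityˡ (a j)))))
              (≤-trans (0<a i) (m≤m+n (a i) (a j))) top
      ... | m , rep , m<2 = a s , (s , refl) , proj₁ top
              , (λ { (t , refl) → proj₂ top t })
              , subst (λ r → r ≡ 0 ⊎ IsCoin r) rep (payment-by-one a m (s≤s⁻¹
                  (subst (Σᶠ m <_) (trans (Σᶠ-+ (copies i 1) (copies j 1))
                    (cong₂ _+_ (Σᶠ-copies i 1) (Σᶠ-copies j 1))) m<2)))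

      small : ∀ {y} → IsCoin y → y < a 3F → y ≤ a 1F ⊎ y ≡ a 2F
      small (0F , refl) _ = inj₁ (mono-≤ 0F 1F z≤n)
      small (1F , refl) _ = inj₁ ≤-refl
      small (2F , refl) _ = inj₂ refl
      small (suc (suc (suc i)) , refl) lt =
        contradiction lt (≤⇒≯ (mono-≤ 3F (suc (suc (suc i))) (s≤s (s≤s (s≤s z≤n)))))

  -- `m` copies of `a i` pay `a j + δ`, whose top coin is `a j`; so `top-residue` pays `δ` with
  -- fewer than `m` coins. These are at most `δ`, hence cost at most 1 each, and `value≤` applies.
  cheap-rest : ∀ {f b} i j {m δ} → Cost f b → m * a i ≡ a j + δ →
    (∀ t → toℕ j < toℕ t → m * a i < a t) → (∀ t → a t ≤ δ → f (a t) ≤ 1) → f δ < m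
  cheap-rest {f} i j {m} {δ} cost eq top one
    with top-residue a a₀ 0<a orderly (copies i m) (value-copies a i m)
           (≤-trans (0<a j) (subst (a j ≤_) (sym eq) (m≤m+n (a j) δ)))
           (subst (a j ≤_) (sym eq) (m≤m+n (a j) δ)
           , λ t at≤ → mono-≤ t j (≮⇒≥ λ j<t → <⇒≱ (top t j<t) at≤))
  ... | m′ , rep , m′<m = ≤-trans (s≤s (subst (λ z → f z ≤ Σᶠ m′) rest
          (Cost.value≤ cost a m′ λ t 0<m′ → one t (≤-trans
            (m≤n*m (a t) (m′ t) {{>-nonZero 0<m′}})
            (subst (m′ t * a t ≤_) rest (term≤Σᶠ (λ i → m′ i * a i) t))))))
          (subst (Σᶠ m′ <_) (Σᶠ-copies i m) m′<m)
    where
      rest : value a m′ ≡ δ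
      rest = trans rep (trans (cong (_∸ a j) eq) (m+n∸m≡n (a j) δ))

  four-orderly : ∀ l → 3 ≤ toℕ l → Orderly (sub4 a l)
  four-orderly l 3≤l
    with extension id (0<a 1F)
  ... | F₁ , ext₁ with extension F₁ (0<a 2F)
  ... | F₂ , ext₂ with extension F₂ (0<a l)
  ... | F₃ , ext₃ with least-multiple (0<a 1F) (a 2F) | least-multiple (0<a 2F) (a l)
  ... | m , δ , eq , δ< | m′ , δ′ , eq′ , δ′< =
    FourCoins.orderly (sub4 a l) (a₀ , mono₄) ext₁ ext₂ ext₃ cost₁ cost₂ cost₃
    where
      mono₄ : ∀ i j → toℕ i < toℕ j → sub4 a l i < sub4 a l j
      mono₄ _ 0F ()
      mono₄ 0F 1F _ = mono 0F 1F (s≤s z≤n)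
      mono₄ (suc _) 1F (s≤s ())
      mono₄ 0F 2F _ = mono 0F 2F (s≤s z≤n)
      mono₄ 1F 2F _ = mono 1F 2F ≤-refl
      mono₄ (suc (suc _)) 2F (s≤s (s≤s ()))
      mono₄ 0F 3F _ = mono 0F l (≤-trans (s≤s z≤n) 3≤l)
      mono₄ 1F 3F _ = mono 1F l (≤-trans (s≤s (s≤s z≤n)) 3≤l)
      mono₄ 2F 3F _ = mono 2F l 3≤l
      mono₄ 3F 3F (s≤s (s≤s (s≤s ())))

      cost₁ : Cost F₁ (a 1F)
      -- Over the coin 1, the multiple is exact: `m = a 1F` and `δ = 0`.
      cost₁ = one-point id-cost (0<a 1F) ext₁
        (trans (*-identityʳ (a 1F)) (sym (+-identityʳ (a 1F)))) (0<a 1F)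

      unit-cost : F₁ (a 0F) ≤ 1
      unit-cost = ≤-reflexive (trans (proj₁ ext₁ (mono 0F 1F (s≤s z≤n))) a₀)

      cost₂ : Cost F₂ (a 2F)
      cost₂ = one-point cost₁ (0<a 2F) ext₂ {m} eq (cheap-rest 1F 2F {m} cost₁ eq
        -- `m * a 1F < a 2F + a 1F < a 2F + a 2F < a 3F`.
        (λ t 2<t → ≤-trans (subst (_< a 2F + a 2F) (sym eq)
            (+-monoʳ-< (a 2F) (<-trans δ< (mono 1F 2F ≤-refl))))
          (≤-trans (<⇒≤ (subst (_< a 3F) (double (a 2F)) 2a₂<a₃)) (mono-≤ 3F t 2<t)))
        -- As `δ < a 1F`, only the coin 1 can occur.
        λ { 0F _ → unit-cost
          ; (suc t) le → contradiction (≤-trans (s≤s le) δ<) (≤⇒≯ (mono-≤ 1F (suc t) (s≤s z≤n))) })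

      cost₃ : Cost F₃ (a l)
      cost₃ = one-point cost₂ (0<a l) ext₃ {m′} eq′ (cheap-rest 2F l {m′} cost₂ eq′
        -- `m′ * a 2F < a l + a 2F ≤ a t`, the last by `coin-gap`.
        (λ t l<t → ≤-trans (subst (_< a l + a 2F) (sym eq′) (+-monoʳ-< (a l) δ′<))
          (coin-gap l t 3≤l l<t))
        λ { 0F _ → subst (_≤ 1) (sym (proj₁ ext₂ (mono 0F 2F (s≤s z≤n)))) unit-cost
          ; 1F _ → subst (_≤ 1) (sym (proj₁ ext₂ (mono 1F 2F ≤-refl))) (Cost.b-one cost₁)
          ; (suc (suc t)) le → contradiction (≤-trans (s≤s le) δ′<)
              (≤⇒≯ (mono-≤ 2F (suc (suc t)) (s≤s (s≤s z≤n)))) })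

theorem7p7 : (m : ℕ) (a : Fin (4 + m) → ℕ) → IsCurrency a → Orderly a →
    2 * a (suc zero) < a (suc (suc zero)) →
    2 * a (suc (suc zero)) < a (suc (suc (suc zero))) →
    (l : Fin (4 + m)) → 4 ≤ toℕ l → Orderly (sub4 a l)
theorem7p7 m a currency orderly 2a₁<a₂ 2a₂<a₃ l 4≤l =
  four-orderly a currency orderly 2a₁<a₂ 2a₂<a₃ l (<⇒≤ 4≤l)
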